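{- Let $G$ be an arbitrary subgroup of $\Gamma=\mathrm{PSL}_2(\mathbb{Z})$. We have $\mathrm{Aut}(Y_{\mathrm{comb}}(G))=N_\Gamma(G)/G$.
   Context: $N_\Gamma(G)$ is the normaliser of $G$ in $\Gamma$; it acts on the set $G\backslash\Gamma$ of cosets $Gx$ by $n\cdot Gx=Gnx$, commuting with the right action of $\Gamma$. Let $G_0,G_1\subset\Gamma$ be the subgroups of order 2 and 3 generated by the classes of $\left(\begin{smallmatrix}0&-1\\1&0\end{smallmatrix}\right)$ and $u=\left(\begin{smallmatrix}0&1\\-1&1\end{smallmatrix}\right)$. $Y_{\mathrm{comb}}(G)$ is the graph (multiple edges allowed) whose vertices of type (0), respectively (1), are the $G_0$-orbits, respectively $G_1$-orbits, in the right $\Gamma$-set $G\backslash\Gamma$, and whose edge set is $G\backslash\Gamma$, the edge $x$ joining the $G_0$-orbit of $x$ with the $G_1$-orbit of $x$. Vertices of type (0) have valency 1 or 2, vertices of type (1) have valency 1 or 3, and the edges at a trivalent vertex of type (1) are cyclically ordered as $x,xu,xu^2$. $\mathrm{Aut}(Y_{\mathrm{comb}}(G))$ is the group of graph automorphisms (compatible bijections of edges and vertices) preserving the types of the vertices and the cyclic orders. The equality means that the groups are identified via the action above. -}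

module Defs where

open import Algebra.Bundles using (Group)
import Algebra.Properties.Group as GroupProperties
open import Data.Fin.Base using (Fin)
open import Data.Integer.Base using (ℤ; 0ℤ; 1ℤ; -1ℤ; _+_; _*_; _-_; -_)
open import Data.Integer.Properties using (_≟_)
open import Data.Integer.Tactic.RingSolver using (solve-∀)
open import Data.Nat.Base using (ℕ)
open import Data.Product.Base using (Σ; Σ-syntax; _×_; _,_; proj₁; proj₂)
open import Data.Sum.Base using (_⊎_; inj₁; inj₂)
open import Function.Base using (id)
open import Function.Bundles using (Func; Inverse; _⇔_; mk⇔; Equivalence)
import Function.Construct.Composition as Compose
import Function.Construct.Identity as Identity
import Function.Construct.Symmetry as Symmetry
open import Level using (Level; _⊔_; 0ℓ) renaming (suc to lsuc)
open import Relation.Binary.Bundles using (Setoid)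
open import Relation.Binary.PropositionalEquality as ≡ using (_≡_; refl; cong; cong₂)
import Relation.Binary.Reasoning.Setoid as SetoidReasoning
open import Relation.Nullary.Decidable.Core using (recompute)

private
  variable
    c ℓ p q r : Level

record Subgroup (Γ : Group c ℓ) (p : Level) : Set (c ⊔ ℓ ⊔ lsuc p) where
  open Group Γ
  field
    Member  : Carrier → Set p
    resp    : ∀ {x y} → x ≈ y → Member x → Member y
    ε-mem   : Member ε
    ∙-mem   : ∀ {x y} → Member x → Member y → Member (x ∙ y)
    ⁻¹-mem  : ∀ {x} → Member x → Member (x ⁻¹)

open Subgroup public using (Member)

infix 4 _∈_
_∈_ : {Γ : Group c ℓ} → Group.Carrier Γ → Subgroup Γ p → Set p
x ∈ H = Member H x

data Generated (Γ : Group c ℓ) (g : Group.Carrier Γ) : Group.Carrier Γ → Set (c ⊔ ℓ) where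
  gen   : Generated Γ g g
  unit  : Generated Γ g (Group.ε Γ)
  mul   : ∀ {x y} → Generated Γ g x → Generated Γ g y → Generated Γ g (Group._∙_ Γ x y)
  inv   : ∀ {x} → Generated Γ g x → Generated Γ g (Group._⁻¹ Γ x)
  equal : ∀ {x y} → Group._≈_ Γ x y → Generated Γ g x → Generated Γ g y

generatedBy : (Γ : Group c ℓ) → Group.Carrier Γ → Subgroup Γ (c ⊔ ℓ)
generatedBy Γ g = record
  { Member = Generated Γ g
  ; resp   = equal
  ; ε-mem  = unit
  ; ∙-mem  = mul
  ; ⁻¹-mem = inv
  }

subgroupGroup : {Γ : Group c ℓ} → Subgroup Γ p → Group (c ⊔ p) ℓ
subgroupGroup {Γ = Γ} H = record
  { Carrier = Σ[ x ∈ Carrier ] Member H x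
  ; _≈_     = λ x y → proj₁ x ≈ proj₁ y
  ; _∙_     = λ (x , x∈) (y , y∈) → x ∙ y , ∙-mem x∈ y∈
  ; ε       = ε , ε-mem
  ; _⁻¹     = λ (x , x∈) → x ⁻¹ , ⁻¹-mem x∈
  ; isGroup = record
    { isMonoid = record
      { isSemigroup = record
        { isMagma = record
          { isEquivalence = record
            { refl = Group.refl Γ ; sym = sym ; trans = trans }
          ; ∙-cong = ∙-cong
          }
        ; assoc = λ x y z → assoc (proj₁ x) (proj₁ y) (proj₁ z)
        }
      ; identity = (λ x → identityˡ (proj₁ x)) , (λ x → identityʳ (proj₁ x))
      }
    ; inverse = (λ x → inverseˡ (proj₁ x)) , (λ x → inverseʳ (proj₁ x))
    ; ⁻¹-cong = ⁻¹-cong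
    }
  }
  where
  open Group Γ hiding (refl)
  open Subgroup H

Normal : {Γ : Group c ℓ} → Subgroup Γ p → Set (c ⊔ p)
Normal {Γ = Γ} H = ∀ x {h} → h ∈ H → (x ∙ h ∙ x ⁻¹) ∈ H
  where open Group Γ

module _ {Γ : Group c ℓ} (H : Subgroup Γ p) where
  open Group Γ hiding (refl)
  open Subgroup H hiding (Member)
  open GroupProperties Γ using (⁻¹-anti-homo-∙; ⁻¹-involutive)
  open SetoidReasoning (Group.setoid Γ)

  -- H x = H y as right cosets.
  SameCoset : Carrier → Carrier → Set p
  SameCoset x y = (x ∙ y ⁻¹) ∈ H

  private
    cancelMiddle : ∀ x y z → (x ∙ y ⁻¹) ∙ (y ∙ z) ≈ x ∙ z
    cancelMiddle x y z = begin
      (x ∙ y ⁻¹) ∙ (y ∙ z)  ≈⟨ assoc x (y ⁻¹) (y ∙ z) ⟩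
      x ∙ (y ⁻¹ ∙ (y ∙ z))  ≈⟨ ∙-congˡ (assoc (y ⁻¹) y z) ⟨
      x ∙ (y ⁻¹ ∙ y ∙ z)    ≈⟨ ∙-congˡ (∙-congʳ (inverseˡ y)) ⟩
      x ∙ (ε ∙ z)           ≈⟨ ∙-congˡ (identityˡ z) ⟩
      x ∙ z                 ∎

    flip-// : ∀ x y → (x ∙ y ⁻¹) ⁻¹ ≈ y ∙ x ⁻¹
    flip-// x y = trans (⁻¹-anti-homo-∙ x (y ⁻¹)) (∙-congʳ (⁻¹-involutive y))

  coset-reflexive : ∀ {x y} → x ≈ y → SameCoset x y
  coset-reflexive {x} {y} x≈y = resp (sym (trans (∙-congʳ x≈y) (inverseʳ y))) ε-mem

  coset-sym : ∀ {x y} → SameCoset x y → SameCoset y x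
  coset-sym {x} {y} xy = resp (flip-// x y) (⁻¹-mem xy)

  coset-trans : ∀ {x y z} → SameCoset x y → SameCoset y z → SameCoset x z
  coset-trans {x} {y} {z} xy yz = resp (cancelMiddle x y (z ⁻¹)) (∙-mem xy yz)

  coset-mulʳ : ∀ {x y} z → SameCoset x y → SameCoset (x ∙ z) (y ∙ z)
  coset-mulʳ {x} {y} z = resp (sym (begin
    x ∙ z ∙ (y ∙ z) ⁻¹      ≈⟨ ∙-congˡ (⁻¹-anti-homo-∙ y z) ⟩
    x ∙ z ∙ (z ⁻¹ ∙ y ⁻¹)   ≈⟨ ∙-congʳ (∙-congˡ (⁻¹-involutive z)) ⟨
    x ∙ z ⁻¹ ⁻¹ ∙ (z ⁻¹ ∙ y ⁻¹) ≈⟨ cancelMiddle x (z ⁻¹) (y ⁻¹) ⟩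
    x ∙ y ⁻¹                ∎))

  coset-mulˡ : ∀ {x y} z → (∀ {h} → h ∈ H → (z ∙ h ∙ z ⁻¹) ∈ H) →
               SameCoset x y → SameCoset (z ∙ x) (z ∙ y)
  coset-mulˡ {x} {y} z conj xy = resp (begin
    z ∙ (x ∙ y ⁻¹) ∙ z ⁻¹   ≈⟨ ∙-congʳ (assoc z x (y ⁻¹)) ⟨
    z ∙ x ∙ y ⁻¹ ∙ z ⁻¹     ≈⟨ assoc (z ∙ x) (y ⁻¹) (z ⁻¹) ⟩
    z ∙ x ∙ (y ⁻¹ ∙ z ⁻¹)   ≈⟨ ∙-congˡ (⁻¹-anti-homo-∙ z y) ⟨
    z ∙ x ∙ (z ∙ y) ⁻¹      ∎) (conj xy)

  cosetSetoid : Setoid c p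
  cosetSetoid = record
    { Carrier = Carrier
    ; _≈_     = SameCoset
    ; isEquivalence = record
      { refl  = coset-reflexive (Group.refl Γ)
      ; sym   = coset-sym
      ; trans = coset-trans
      }
    }

  quotient : Normal H → Group c p
  quotient normal = record
    { Carrier = Carrier
    ; _≈_     = SameCoset
    ; _∙_     = _∙_
    ; ε       = ε
    ; _⁻¹     = _⁻¹
    ; isGroup = record
      { isMonoid = record
        { isSemigroup = record
          { isMagma = record
            { isEquivalence = Setoid.isEquivalence cosetSetoid
            ; ∙-cong = λ {x} {y} {u} {v} xy uv →
                coset-trans (coset-mulʳ u xy) (coset-mulˡ y (normal y) uv)
            }
          ; assoc = λ x y z → coset-reflexive (assoc x y z)
          }
        ; identity = (λ x → coset-reflexive (identityˡ x))
                   , (λ x → coset-reflexive (identityʳ x))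
        }
      ; inverse = (λ x → coset-reflexive (inverseˡ x))
                , (λ x → coset-reflexive (inverseʳ x))
      ; ⁻¹-cong = λ {x} {y} xy → resp (begin
          x ⁻¹ ∙ (x ∙ y ⁻¹) ⁻¹ ∙ x ⁻¹ ⁻¹    ≈⟨ ∙-cong (∙-congˡ (flip-// x y)) (⁻¹-involutive x) ⟩
          x ⁻¹ ∙ (y ∙ x ⁻¹) ∙ x             ≈⟨ assoc (x ⁻¹) (y ∙ x ⁻¹) x ⟩
          x ⁻¹ ∙ (y ∙ x ⁻¹ ∙ x)             ≈⟨ ∙-congˡ (assoc y (x ⁻¹) x) ⟩
          x ⁻¹ ∙ (y ∙ (x ⁻¹ ∙ x))           ≈⟨ ∙-congˡ (∙-congˡ (inverseˡ x)) ⟩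
          x ⁻¹ ∙ (y ∙ ε)                    ≈⟨ ∙-congˡ (identityʳ y) ⟩
          x ⁻¹ ∙ y                          ≈⟨ ∙-congˡ (⁻¹-involutive y) ⟨
          x ⁻¹ ∙ y ⁻¹ ⁻¹                    ∎)
          (normal (x ⁻¹) (⁻¹-mem xy))
      }
    }

-- The elements n with n H n⁻¹ = H; n h n⁻¹ ∈ H for all h ∈ H would only give
-- the inclusion n H n⁻¹ ⊆ H.
normaliser : {Γ : Group c ℓ} → Subgroup Γ p → Subgroup Γ (c ⊔ p)
normaliser {Γ = Γ} H = record
  { Member = λ n → ∀ x → x ∈ H ⇔ (n ∙ x ∙ n ⁻¹) ∈ H
  ; resp   = λ m≈n mem x → mk⇔
      (λ x∈ → resp (conj-cong m≈n) (to (mem x) x∈))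
      (λ nx∈ → from (mem x) (resp (conj-cong (sym m≈n)) nx∈))
  ; ε-mem  = λ x → mk⇔ (resp (sym (conj-ε x))) (resp (conj-ε x))
  ; ∙-mem  = λ {m} {n} m∈ n∈ x → mk⇔
      (λ x∈ → resp (conj-∙ m n x) (to (m∈ _) (to (n∈ x) x∈)))
      (λ mnx∈ → from (n∈ x) (from (m∈ _) (resp (sym (conj-∙ m n x)) mnx∈)))
  ; ⁻¹-mem = λ {n} n∈ x → mk⇔
      (λ x∈ → from (n∈ _) (resp (sym (conj-conj⁻¹ n x)) x∈))
      (λ nx∈ → resp (conj-conj⁻¹ n x) (to (n∈ _) nx∈))
  }
  where
  open Group Γ hiding (refl)
  open Subgroup H
  open Equivalence
  open GroupProperties Γ using (⁻¹-anti-homo-∙; ε⁻¹≈ε)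
  open SetoidReasoning (Group.setoid Γ)

  conj-cong : ∀ {m n x} → m ≈ n → m ∙ x ∙ m ⁻¹ ≈ n ∙ x ∙ n ⁻¹
  conj-cong m≈n = ∙-cong (∙-congʳ m≈n) (⁻¹-cong m≈n)

  conj-ε : ∀ x → ε ∙ x ∙ ε ⁻¹ ≈ x
  conj-ε x = begin
    ε ∙ x ∙ ε ⁻¹  ≈⟨ ∙-cong (identityˡ x) ε⁻¹≈ε ⟩
    x ∙ ε         ≈⟨ identityʳ x ⟩
    x             ∎

  conj-∙ : ∀ m n x → m ∙ (n ∙ x ∙ n ⁻¹) ∙ m ⁻¹ ≈ (m ∙ n) ∙ x ∙ (m ∙ n) ⁻¹
  conj-∙ m n x = begin
    m ∙ (n ∙ x ∙ n ⁻¹) ∙ m ⁻¹    ≈⟨ ∙-congʳ (assoc m (n ∙ x) (n ⁻¹)) ⟨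
    m ∙ (n ∙ x) ∙ n ⁻¹ ∙ m ⁻¹    ≈⟨ ∙-congʳ (∙-congʳ (assoc m n x)) ⟨
    m ∙ n ∙ x ∙ n ⁻¹ ∙ m ⁻¹      ≈⟨ assoc (m ∙ n ∙ x) (n ⁻¹) (m ⁻¹) ⟩
    m ∙ n ∙ x ∙ (n ⁻¹ ∙ m ⁻¹)    ≈⟨ ∙-congˡ (⁻¹-anti-homo-∙ m n) ⟨
    m ∙ n ∙ x ∙ (m ∙ n) ⁻¹       ∎

  conj-conj⁻¹ : ∀ n x → n ∙ (n ⁻¹ ∙ x ∙ n ⁻¹ ⁻¹) ∙ n ⁻¹ ≈ x
  conj-conj⁻¹ n x = begin
    n ∙ (n ⁻¹ ∙ x ∙ n ⁻¹ ⁻¹) ∙ n ⁻¹       ≈⟨ conj-∙ n (n ⁻¹) x ⟩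
    (n ∙ n ⁻¹) ∙ x ∙ (n ∙ n ⁻¹) ⁻¹        ≈⟨ conj-cong (inverseʳ n) ⟩
    ε ∙ x ∙ ε ⁻¹                          ≈⟨ conj-ε x ⟩
    x                                     ∎

inNormaliser : {Γ : Group c ℓ} (H : Subgroup Γ p) →
               Subgroup (subgroupGroup (normaliser H)) p
inNormaliser H = record
  { Member = λ n → Member H (proj₁ n)
  ; resp   = resp
  ; ε-mem  = ε-mem
  ; ∙-mem  = ∙-mem
  ; ⁻¹-mem = ⁻¹-mem
  }
  where open Subgroup H

normaliserQuotient : {Γ : Group c ℓ} → Subgroup Γ p → Group (c ⊔ p) p
normaliserQuotient H =
  quotient (inNormaliser H) (λ (n , n∈) {h} h∈ → Equivalence.to (n∈ (proj₁ h)) h∈)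

record RightSet (Γ : Group c ℓ) (a p : Level) : Set (c ⊔ ℓ ⊔ lsuc (a ⊔ p)) where
  open Group Γ using (_∙_; ε) renaming (Carrier to ∣Γ∣; _≈_ to _≈Γ_)
  field
    setoid : Setoid a p
  open Setoid setoid using (Carrier; _≈_)
  infixl 7 _·_
  field
    _·_        : Carrier → ∣Γ∣ → Carrier
    ·-cong     : ∀ {x y g h} → x ≈ y → g ≈Γ h → x · g ≈ y · h
    ·-identity : ∀ x → x · ε ≈ x
    ·-assoc    : ∀ x g h → x · (g ∙ h) ≈ x · g · h

rightCosets : {Γ : Group c ℓ} → Subgroup Γ p → RightSet Γ c p
rightCosets {Γ = Γ} H = record
  { setoid     = cosetSetoid H
  ; _·_        = _∙_
  ; ·-cong     = λ {x} {y} {g} {h} xy gh →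
      coset-trans H (coset-mulʳ H g xy) (coset-reflexive H (∙-congˡ gh))
  ; ·-identity = λ x → coset-reflexive H (identityʳ x)
  ; ·-assoc    = λ x g h → coset-reflexive H (sym (assoc x g h))
  }
  where open Group Γ

-- An orbit is represented by any of its points.
orbits : ∀ {a} {Γ : Group c ℓ} → RightSet Γ a p → Subgroup Γ q → Setoid a (c ⊔ p ⊔ q)
orbits {Γ = Γ} X H = record
  { Carrier = Setoid.Carrier setoid
  ; _≈_     = λ x y → Σ[ h ∈ ∣Γ∣ ] h ∈ H × x · h ≈ y
  ; isEquivalence = record
    { refl  = λ {x} → ε , ε-mem , ·-identity x
    ; sym   = λ {x} {y} (h , h∈ , xh≈y) → h ⁻¹ , ⁻¹-mem h∈ ,
        trans (·-cong (sym xh≈y) (Group.refl Γ))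
          (trans (sym (·-assoc x h (h ⁻¹)))
            (trans (·-cong (Setoid.refl setoid) (inverseʳ h)) (·-identity x)))
    ; trans = λ {x} {y} {z} (h , h∈ , xh≈y) (k , k∈ , yk≈z) → h ∙ k , ∙-mem h∈ k∈ ,
        trans (·-assoc x h k) (trans (·-cong xh≈y (Group.refl Γ)) yk≈z)
    }
  }
  where
  open RightSet X
  open Setoid setoid using (_≈_; sym; trans)
  open Subgroup H
  open Group Γ using (_∙_; ε; _⁻¹; inverseʳ) renaming (Carrier to ∣Γ∣)

data VertexType : Set where
  type0 type1 : VertexType

-- Every edge has one endpoint of each type; multiple edges are allowed.
record Graph (a p : Level) : Set (lsuc (a ⊔ p)) where
  field
    edges    : Setoid a p
    vertices : VertexType → Setoid a p
    end      : ∀ t → Func edges (vertices t)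

  Edge : Set a
  Edge = Setoid.Carrier edges

  Vertex : VertexType → Set a
  Vertex t = Setoid.Carrier (vertices t)

  endpoint : ∀ t → Edge → Vertex t
  endpoint t = Func.to (end t)

  star : ∀ t → Vertex t → Setoid (a ⊔ p) p
  star t v = record
    { Carrier = Σ[ e ∈ Edge ] Setoid._≈_ (vertices t) (endpoint t e) v
    ; _≈_     = λ e f → Setoid._≈_ edges (proj₁ e) (proj₁ f)
    ; isEquivalence = record
      { refl = Setoid.refl edges ; sym = Setoid.sym edges ; trans = Setoid.trans edges }
    }

  HasValency : ∀ t → Vertex t → ℕ → Set (a ⊔ p)
  HasValency t v n = Inverse (≡.setoid (Fin n)) (star t v)

  valency-resp : ∀ t {v w n} → Setoid._≈_ (vertices t) v w →
                 HasValency t v n → HasValency t w n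
  valency-resp t v≈w val = record
    { to        = λ i → proj₁ (to i) , Setoid.trans (vertices t) (proj₂ (to i)) v≈w
    ; from      = λ (e , e≈w) →
        from (e , Setoid.trans (vertices t) e≈w (Setoid.sym (vertices t) v≈w))
    ; to-cong   = to-cong
    ; from-cong = from-cong
    ; inverse   = inverseˡ , inverseʳ
    }
    where open Inverse val

-- Cyclic x y z says that x, y, z are the edges at some vertex, listed in the
-- cyclic order starting from x.
record CyclicGraph (a p r : Level) : Set (lsuc (a ⊔ p ⊔ r)) where
  field
    graph : Graph a p
  open Graph graph public
  field
    Cyclic      : Edge → Edge → Edge → Set r
    cyclic-resp : ∀ {x x′ y y′ z z′} → Setoid._≈_ edges x x′ → Setoid._≈_ edges y y′ →
                  Setoid._≈_ edges z z′ → Cyclic x y z → Cyclic x′ y′ z′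

module _ {a} (Y : CyclicGraph a p r) where
  open CyclicGraph Y
  private
    module E = Setoid edges
    module V t = Setoid (vertices t)

  -- A type-preserving bijection of the vertices is a bijection for each type.
  record Automorphism : Set (a ⊔ p ⊔ r) where
    field
      edge   : Inverse edges edges
      vertex : ∀ t → Inverse (vertices t) (vertices t)

    onEdges : Edge → Edge
    onEdges = Inverse.to edge

    onVertices : ∀ t → Vertex t → Vertex t
    onVertices t = Inverse.to (vertex t)

    field
      compatible : ∀ t e → V._≈_ t (endpoint t (onEdges e)) (onVertices t (endpoint t e))
      cyclic     : ∀ x y z → Cyclic x y z ⇔ Cyclic (onEdges x) (onEdges y) (onEdges z)

  open Automorphism

  composeAut : Automorphism → Automorphism → Automorphism
  composeAut f g = record
    { edge       = Compose.inverse (edge g) (edge f)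
    ; vertex     = λ t → Compose.inverse (vertex g t) (vertex f t)
    ; compatible = λ t e → V.trans t (compatible f t (onEdges g e))
                             (Inverse.to-cong (vertex f t) (compatible g t e))
    ; cyclic     = λ x y z → Compose.equivalence (cyclic g x y z) (cyclic f _ _ _)
    }

  identityAut : Automorphism
  identityAut = record
    { edge       = Identity.inverse edges
    ; vertex     = λ t → Identity.inverse (vertices t)
    ; compatible = λ t e → V.refl t
    ; cyclic     = λ x y z → mk⇔ id id
    }

  inverseAut : Automorphism → Automorphism
  inverseAut f = record
    { edge       = Symmetry.inverse (edge f)
    ; vertex     = λ t → Symmetry.inverse (vertex f t)
    ; compatible = λ t e → V.sym t (Inverse.inverseʳ (vertex f t)
        (V.trans t (V.sym t (Func.cong (end t) (to∘from e))) (compatible f t (from e))))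
    ; cyclic     = λ x y z → mk⇔
        (λ xyz → Equivalence.from (cyclic f _ _ _)
          (cyclic-resp (E.sym (to∘from x)) (E.sym (to∘from y)) (E.sym (to∘from z)) xyz))
        (λ xyz → cyclic-resp (to∘from x) (to∘from y) (to∘from z)
          (Equivalence.to (cyclic f _ _ _) xyz))
    }
    where
    from : Edge → Edge
    from = Inverse.from (edge f)
    to∘from : ∀ e → E._≈_ (onEdges f (from e)) e
    to∘from = Inverse.strictlyInverseˡ (edge f)

  automorphismGroup : Group (a ⊔ p ⊔ r) (a ⊔ p)
  automorphismGroup = record
    { Carrier = Automorphism
    ; _≈_     = λ f g → (∀ e → E._≈_ (onEdges f e) (onEdges g e))
                      × (∀ t v → V._≈_ t (onVertices f t v) (onVertices g t v))
    ; _∙_     = composeAut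
    ; ε       = identityAut
    ; _⁻¹     = inverseAut
    ; isGroup = record
      { isMonoid = record
        { isSemigroup = record
          { isMagma = record
            { isEquivalence = record
              { refl  = (λ e → E.refl) , (λ t v → V.refl t)
              ; sym   = λ (p , q) → (λ e → E.sym (p e)) , (λ t v → V.sym t (q t v))
              ; trans = λ (p , q) (p′ , q′) →
                  (λ e → E.trans (p e) (p′ e)) , (λ t v → V.trans t (q t v) (q′ t v))
              }
            ; ∙-cong = λ {f} {f′} {g} {g′} (p , q) (p′ , q′) →
                (λ e → E.trans (Inverse.to-cong (edge f) (p′ e)) (p (onEdges g′ e)))
              , (λ t v → V.trans t (Inverse.to-cong (vertex f t) (q′ t v))
                                   (q t (onVertices g′ t v)))
            }
          ; assoc = λ f g h → (λ e → E.refl) , (λ t v → V.refl t)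
          }
        ; identity = (λ f → (λ e → E.refl) , (λ t v → V.refl t))
                   , (λ f → (λ e → E.refl) , (λ t v → V.refl t))
        }
      ; inverse = (λ f → (λ e → Inverse.strictlyInverseʳ (edge f) e)
                       , (λ t v → Inverse.strictlyInverseʳ (vertex f t) v))
                , (λ f → (λ e → Inverse.strictlyInverseˡ (edge f) e)
                       , (λ t v → Inverse.strictlyInverseˡ (vertex f t) v))
      ; ⁻¹-cong = λ {f} {g} (p , q) →
          (λ e → Inverse.inverseʳ (edge f)
            (E.trans (E.sym (Inverse.strictlyInverseˡ (edge g) e))
                     (E.sym (p (Inverse.from (edge g) e)))))
        , (λ t v → Inverse.inverseʳ (vertex f t)
            (V.trans t (V.sym t (Inverse.strictlyInverseˡ (vertex g t) v))
                       (V.sym t (q t (Inverse.from (vertex g t) v)))))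
      }
    }

-- For a right Γ-set X: the edges are the points of X, the vertices of type t are
-- the orbits of H t, and the edges at a vertex of type (1) which has valency 3
-- are cyclically ordered as x, x g, x g².
module _ {Γ : Group 0ℓ 0ℓ} (X : RightSet Γ 0ℓ p)
         (H : VertexType → Subgroup Γ 0ℓ) (g : Group.Carrier Γ) where
  open RightSet X
  open Setoid setoid using (_≈_; sym; trans)
  open Group Γ using (_∙_; ε)

  orbitGraph : Graph 0ℓ p
  orbitGraph = record
    { edges    = setoid
    ; vertices = λ t → orbits X (H t)
    ; end      = λ t → record
      { to   = id
      ; cong = λ {x} x≈y → ε , Subgroup.ε-mem (H t) , trans (·-identity x) x≈y
      }
    }

  open Graph orbitGraph

  orbitCyclicGraph : CyclicGraph 0ℓ p p
  orbitCyclicGraph = record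
    { graph       = orbitGraph
    ; Cyclic      = λ x y z → HasValency type1 (endpoint type1 x) 3
                            × y ≈ x · g × z ≈ x · (g ∙ g)
    ; cyclic-resp = λ {x} {x′} x≈x′ y≈y′ z≈z′ (val , y≈ , z≈) →
          valency-resp type1 (Func.cong (end type1) {x} {x′} x≈x′) val
        , trans (sym y≈y′) (trans y≈ (·-cong x≈x′ (Group.refl Γ)))
        , trans (sym z≈z′) (trans z≈ (·-cong x≈x′ (Group.refl Γ)))
    }

-- mat a b c d is the matrix with rows (a b) and (c d).
record Mat₂ : Set where
  no-eta-equality
  pattern
  constructor mat
  field
    a₁₁ a₁₂ a₂₁ a₂₂ : ℤ

det : Mat₂ → ℤ
det (mat a b c d) = a * d - b * c

infixl 7 _⊗_
_⊗_ : Mat₂ → Mat₂ → Mat₂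
mat a b c d ⊗ mat a′ b′ c′ d′ =
  mat (a * a′ + b * c′) (a * b′ + b * d′) (c * a′ + d * c′) (c * b′ + d * d′)

adjugate : Mat₂ → Mat₂
adjugate (mat a b c d) = mat d (- b) (- c) a

I -I : Mat₂
I  = mat 1ℤ 0ℤ 0ℤ 1ℤ
-I = mat -1ℤ 0ℤ 0ℤ -1ℤ

private
  mat-cong : ∀ {a a′ b b′ c c′ d d′} → a ≡ a′ → b ≡ b′ → c ≡ c′ → d ≡ d′ →
             mat a b c d ≡ mat a′ b′ c′ d′
  mat-cong refl refl refl refl = refl

det-⊗ : ∀ A B → det (A ⊗ B) ≡ det A * det B
det-⊗ (mat a b c d) (mat a′ b′ c′ d′) = lemma a b c d a′ b′ c′ d′
  where
  lemma : ∀ a b c d e f g h →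
    (a * e + b * g) * (c * f + d * h) - (a * f + b * h) * (c * e + d * g)
      ≡ (a * d - b * c) * (e * h - f * g)
  lemma = solve-∀

det-adjugate : ∀ A → det (adjugate A) ≡ det A
det-adjugate (mat a b c d) = lemma a b c d
  where
  lemma : ∀ a b c d → d * a - (- b) * (- c) ≡ a * d - b * c
  lemma = solve-∀

⊗-assoc : ∀ A B C → (A ⊗ B) ⊗ C ≡ A ⊗ (B ⊗ C)
⊗-assoc (mat a b c d) (mat a′ b′ c′ d′) (mat a″ b″ c″ d″) = mat-cong
  (lemma a b a′ b′ c′ d′ a″ c″) (lemma a b a′ b′ c′ d′ b″ d″)
  (lemma c d a′ b′ c′ d′ a″ c″) (lemma c d a′ b′ c′ d′ b″ d″)
  where
  lemma : ∀ x y a b c d z w →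
    (x * a + y * c) * z + (x * b + y * d) * w ≡ x * (a * z + b * w) + y * (c * z + d * w)
  lemma = solve-∀

⊗-identityˡ : ∀ A → I ⊗ A ≡ A
⊗-identityˡ (mat a b c d) = mat-cong (top a c) (top b d) (bot a c) (bot b d)
  where
  top : ∀ x y → 1ℤ * x + 0ℤ * y ≡ x
  top = solve-∀
  bot : ∀ x y → 0ℤ * x + 1ℤ * y ≡ y
  bot = solve-∀

⊗-identityʳ : ∀ A → A ⊗ I ≡ A
⊗-identityʳ (mat a b c d) = mat-cong (left a b) (right a b) (left c d) (right c d)
  where
  left : ∀ x y → x * 1ℤ + y * 0ℤ ≡ x
  left = solve-∀
  right : ∀ x y → x * 0ℤ + y * 1ℤ ≡ y
  right = solve-∀

adjugate-inverseˡ : ∀ A → det A ≡ 1ℤ → adjugate A ⊗ A ≡ I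
adjugate-inverseˡ (mat a b c d) det≡1 = mat-cong
  (≡.trans (diag₁ a b c d) det≡1) (off₁ b d) (off₂ a c) (≡.trans (diag₂ a b c d) det≡1)
  where
  diag₁ : ∀ a b c d → d * a + (- b) * c ≡ a * d - b * c
  diag₁ = solve-∀
  off₁ : ∀ b d → d * b + (- b) * d ≡ 0ℤ
  off₁ = solve-∀
  off₂ : ∀ a c → (- c) * a + a * c ≡ 0ℤ
  off₂ = solve-∀
  diag₂ : ∀ a b c d → (- c) * b + a * d ≡ a * d - b * c
  diag₂ = solve-∀

adjugate-inverseʳ : ∀ A → det A ≡ 1ℤ → A ⊗ adjugate A ≡ I
adjugate-inverseʳ (mat a b c d) det≡1 = mat-cong
  (≡.trans (diag₁ a b c d) det≡1) (off₁ a b) (off₂ c d) (≡.trans (diag₂ a b c d) det≡1)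
  where
  diag₁ : ∀ a b c d → a * d + b * (- c) ≡ a * d - b * c
  diag₁ = solve-∀
  off₁ : ∀ a b → a * (- b) + b * a ≡ 0ℤ
  off₁ = solve-∀
  off₂ : ∀ c d → c * d + d * (- c) ≡ 0ℤ
  off₂ = solve-∀
  diag₂ : ∀ a b c d → c * (- b) + d * a ≡ a * d - b * c
  diag₂ = solve-∀

record SL₂ : Set where
  constructor sl
  field
    matrix : Mat₂
    .det≡1 : det matrix ≡ 1ℤ

open SL₂ public using (matrix)

det-matrix : ∀ A → det (matrix A) ≡ 1ℤ
det-matrix (sl A detA) = recompute (det A ≟ 1ℤ) detA

SL₂ℤ : Group 0ℓ 0ℓ
SL₂ℤ = record
  { Carrier = SL₂
  ; _≈_     = λ A B → matrix A ≡ matrix B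
  ; _∙_     = λ (sl A detA) (sl B detB) →
      sl (A ⊗ B) (≡.trans (det-⊗ A B) (cong₂ _*_ detA detB))
  ; ε       = sl I refl
  ; _⁻¹     = λ (sl A detA) → sl (adjugate A) (≡.trans (det-adjugate A) detA)
  ; isGroup = record
    { isMonoid = record
      { isSemigroup = record
        { isMagma = record
          { isEquivalence = record { refl = refl ; sym = ≡.sym ; trans = ≡.trans }
          ; ∙-cong = cong₂ _⊗_
          }
        ; assoc = λ A B C → ⊗-assoc (matrix A) (matrix B) (matrix C)
        }
      ; identity = (λ A → ⊗-identityˡ (matrix A)) , (λ A → ⊗-identityʳ (matrix A))
      }
    ; inverse = (λ A → adjugate-inverseˡ (matrix A) (det-matrix A))
              , (λ A → adjugate-inverseʳ (matrix A) (det-matrix A))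
    ; ⁻¹-cong = cong adjugate
    }
  }

±I : Subgroup SL₂ℤ 0ℓ
±I = record
  { Member = λ A → matrix A ≡ I ⊎ matrix A ≡ -I
  ; resp   = λ { refl A∈ → A∈ }
  ; ε-mem  = inj₁ refl
  ; ∙-mem  = λ
    { (inj₁ refl) (inj₁ refl) → inj₁ refl
    ; (inj₁ refl) (inj₂ refl) → inj₂ refl
    ; (inj₂ refl) (inj₁ refl) → inj₂ refl
    ; (inj₂ refl) (inj₂ refl) → inj₁ refl
    }
  ; ⁻¹-mem = λ { (inj₁ refl) → inj₁ refl ; (inj₂ refl) → inj₂ refl }
  }

±I-normal : Normal ±I
±I-normal x@(sl A _) (inj₁ refl) =
  inj₁ (≡.trans (cong (_⊗ adjugate A) (⊗-identityʳ A)) (adjugate-inverseʳ A (det-matrix x)))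
±I-normal x@(sl A _) (inj₂ refl) = inj₂ (≡.trans
  (cong (_⊗ adjugate A) (central A))
  (≡.trans (⊗-assoc -I A (adjugate A))
    (cong (-I ⊗_) (adjugate-inverseʳ A (det-matrix x)))))
  where
  central : ∀ A → A ⊗ -I ≡ -I ⊗ A
  central (mat a b c d) = mat-cong (left a b c) (right a b d) (left′ a c d) (right′ b c d)
    where
    left : ∀ a b c → a * -1ℤ + b * 0ℤ ≡ -1ℤ * a + 0ℤ * c
    left = solve-∀
    right : ∀ a b d → a * 0ℤ + b * -1ℤ ≡ -1ℤ * b + 0ℤ * d
    right = solve-∀
    left′ : ∀ a c d → c * -1ℤ + d * 0ℤ ≡ 0ℤ * a + -1ℤ * c
    left′ = solve-∀
    right′ : ∀ b c d → c * 0ℤ + d * -1ℤ ≡ 0ℤ * b + -1ℤ * d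
    right′ = solve-∀

PSL₂ℤ : Group 0ℓ 0ℓ
PSL₂ℤ = quotient ±I ±I-normal

s u : Group.Carrier PSL₂ℤ
s = sl (mat 0ℤ -1ℤ 1ℤ 0ℤ) refl
u = sl (mat 0ℤ 1ℤ -1ℤ 1ℤ) refl

G[_] : VertexType → Subgroup PSL₂ℤ 0ℓ
G[ type0 ] = generatedBy PSL₂ℤ s
G[ type1 ] = generatedBy PSL₂ℤ u

{-# OPTIONS --safe #-}

-- An automorphism f of the orbit graph of a right PSL₂(ℤ)-set X commutes with s:
-- x s is the other edge at the (0)-vertex of x, and if x s = x, then the vertex has
-- valency 1, hence so has its image. It commutes with u in the same way, the cyclic
-- order distinguishing x u from x u². Since s and u generate PSL₂(ℤ) by the Euclidean
-- algorithm, f is an automorphism of the right PSL₂(ℤ)-set X. For X = G\Γ it is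
-- therefore determined by f(G) = G n, it sends G x to G n x, and n normalises G.
module Submission where

open import Defs
open import Algebra.Bundles using (Group)
import Algebra.Definitions.RawMonoid as RawMonoid
open import Algebra.Morphism.Structures using (module GroupMorphisms)
import Algebra.Properties.Group as GroupProperties
import Algebra.Properties.Monoid.Mult as MonoidMult
open import Axiom.ExcludedMiddle using (ExcludedMiddle)
open import Data.Fin.Base using (Fin; toℕ; fromℕ<)
open import Data.Fin.Patterns using (0F; 1F; 2F)
open import Data.Fin.Properties using (toℕ-fromℕ<)
open import Data.Integer.Base using (ℤ; +_; -[1+_]; +[1+_]; NonZero; 0ℤ; 1ℤ; -1ℤ; _+_; _*_; _-_; -_; ∣_∣)
open import Data.Integer.DivMod using (_/_; _%_; n%d<d; a≡a%n+[a/n]*n)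
open import Data.Integer.Properties using (abs-*; ∣-i∣≡∣i∣)
open import Data.Integer.Tactic.RingSolver using (solve-∀)
open import Data.Nat.Base as ℕ using (ℕ; zero; suc)
import Data.Nat.DivMod as ℕ
open import Data.Nat.Induction using (Acc; acc; <-wellFounded)
import Data.Nat.Properties as ℕ
open import Data.Product using (Σ; _×_; _,_; proj₁; proj₂)
open import Data.Sum.Base using (inj₂)
open import Function.Bundles using (Func; Inverse; mk⇔; Equivalence)
import Function.Construct.Composition as Compose
open import Level using (Level; _⊔_; 0ℓ)
open import Relation.Binary.Bundles using (Setoid)
open import Relation.Binary.PropositionalEquality as ≡ using (_≡_; refl; cong; subst)
import Relation.Binary.Reasoning.Setoid as SetoidReasoning
open import Relation.Nullary using (¬_; yes; no; contradiction)

private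
  variable
    p : Level

-- Generation of PSL₂(ℤ) by `s` and `u`

module _ (K : Subgroup PSL₂ℤ p) (s∈K : s ∈ K) (u∈K : u ∈ K) where
  open Group PSL₂ℤ using (_∙_; _⁻¹; ε)
  open Subgroup K hiding (Member)

  private
    matrix-resp : ∀ A B → matrix A ≡ matrix B → A ∈ K → B ∈ K
    matrix-resp A B A≡B = resp {A} {B} (coset-reflexive ±I {A} {B} A≡B)

    mat-cong : ∀ {a a′ b b′ c c′ d d′} → a ≡ a′ → b ≡ b′ → c ≡ c′ → d ≡ d′ →
               mat a b c d ≡ mat a′ b′ c′ d′
    mat-cong refl refl refl refl = refl

    -- The parabolic elements fixing infinity, acting as z ↦ z + k.
    T : ℤ → SL₂
    T k = sl (mat 1ℤ k 0ℤ 1ℤ) (det-T k)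
      where
      det-T : ∀ k → 1ℤ * 1ℤ - k * 0ℤ ≡ 1ℤ
      det-T = solve-∀

    T-+ : ∀ j k → matrix (T j ∙ T k) ≡ matrix (T (j + k))
    T-+ j k = mat-cong (e₁₁ j) (e₁₂ j k) refl (e₂₂ k)
      where
      e₁₁ : ∀ j → 1ℤ * 1ℤ + j * 0ℤ ≡ 1ℤ
      e₁₁ = solve-∀
      e₁₂ : ∀ j k → 1ℤ * k + j * 1ℤ ≡ j + k
      e₁₂ = solve-∀
      e₂₂ : ∀ k → 0ℤ * k + 1ℤ * 1ℤ ≡ 1ℤ
      e₂₂ = solve-∀

    T₋₁∈K : T -1ℤ ∈ K
    T₋₁∈K = matrix-resp (s ∙ u) (T -1ℤ) refl (∙-mem s∈K u∈K)

    T₁∈K : T 1ℤ ∈ K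
    T₁∈K = matrix-resp (T -1ℤ ⁻¹) (T 1ℤ) refl (⁻¹-mem {T -1ℤ} T₋₁∈K)

    T∈K : ∀ k → T k ∈ K
    T∈K (+ zero)      = matrix-resp ε (T 0ℤ) refl ε-mem
    T∈K +[1+ k ]      = matrix-resp (T 1ℤ ∙ T (+ k)) (T +[1+ k ]) (T-+ 1ℤ (+ k))
                          (∙-mem {T 1ℤ} {T (+ k)} T₁∈K (T∈K (+ k)))
    T∈K -[1+ zero ]   = T₋₁∈K
    T∈K -[1+ suc k ]  = matrix-resp (T -1ℤ ∙ T -[1+ k ]) (T -[1+ suc k ]) (T-+ -1ℤ -[1+ k ])
                          (∙-mem {T -1ℤ} {T -[1+ k ]} T₋₁∈K (T∈K -[1+ k ]))

    a₂₁ : SL₂ → ℤ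
    a₂₁ A = Mat₂.a₂₁ (matrix A)

    -- The determinant is now `a * d`, so `a` and `d` are both 1 or both -1, and `A` is `T b` or the
    -- negative of `T (- b)`.
    upperTriangular∈K : ∀ A → a₂₁ A ≡ 0ℤ → A ∈ K
    upperTriangular∈K A@(sl (mat a b .0ℤ d) _) refl =
      cases a d (ℕ.m*n≡1⇒m≡1 ∣ a ∣ ∣ d ∣ (≡.trans (≡.sym (abs-* a d)) (cong ∣_∣ ad≡1))) ad≡1
        (λ B → matrix-resp B A)
      where
      drop : ∀ a b d → a * d ≡ a * d - b * 0ℤ
      drop = solve-∀
      ad≡1 : a * d ≡ 1ℤ
      ad≡1 = ≡.trans (drop a b d) (det-matrix A)
      1*d : ∀ d → 1ℤ * d ≡ d
      1*d = solve-∀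
      -1*d : ∀ d → d ≡ - (-1ℤ * d)
      -1*d = solve-∀
      e₁₂ : ∀ b → -1ℤ * (- b) + 0ℤ * 1ℤ ≡ b
      e₁₂ = solve-∀
      e₂₂ : ∀ b → 0ℤ * (- b) + -1ℤ * 1ℤ ≡ -1ℤ
      e₂₂ = solve-∀
      -- The continuation keeps `A` fixed while its diagonal entries, as fresh variables, are split
      -- into cases.
      cases : ∀ a d → ∣ a ∣ ≡ 1 → a * d ≡ 1ℤ →
              (∀ B → matrix B ≡ mat a b 0ℤ d → B ∈ K → A ∈ K) → A ∈ K
      cases (+ 1) d _ ad≡1 k =
        k (T b) (cong (mat 1ℤ b 0ℤ) (≡.trans (≡.sym ad≡1) (1*d d))) (T∈K b)
      cases -[1+ 0 ] d _ ad≡1 k =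
        -- The matrix of `s ∙ s` is `-I`, which supplies the sign.
        k (s ∙ s ∙ T (- b))
          (mat-cong refl (e₁₂ b) refl
            (≡.trans (e₂₂ b) (≡.sym (≡.trans (-1*d d) (cong -_ ad≡1)))))
          (∙-mem {s ∙ s} {T (- b)} (∙-mem s∈K s∈K) (T∈K (- b)))

    -- For a = q c + r, left multiplication of A by (T q s)⁻¹ replaces its first
    -- column (a, c) by (c, − r).
    euclidStep : ∀ A .{{_ : NonZero (a₂₁ A)}} →
                 (∀ B → ∣ a₂₁ B ∣ ℕ.< ∣ a₂₁ A ∣ → B ∈ K) → A ∈ K
    euclidStep A@(sl (mat a b c d) _) smaller∈K =
      resp {Tqs ∙ B} {A} (\\-leftDividesˡ Tqs A) (∙-mem {Tqs} {B}
        (∙-mem {T q} {s} (T∈K q) s∈K)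
        (smaller∈K B (subst (ℕ._< ∣ c ∣) (≡.sym ∣B₂₁∣≡r) (n%d<d a c))))
      where
      open GroupProperties PSL₂ℤ using (\\-leftDividesˡ)
      q = a / c
      r = a % c
      Tqs = T q ∙ s
      B = Tqs ⁻¹ ∙ A
      reduce : ∀ r q c → -1ℤ * (r + q * c) + (1ℤ * 0ℤ + q * 1ℤ) * c ≡ - r
      reduce = solve-∀
      ∣B₂₁∣≡r : ∣ a₂₁ B ∣ ≡ r
      ∣B₂₁∣≡r = ≡.trans (cong ∣_∣ (≡.trans
        (cong (λ a → -1ℤ * a + (1ℤ * 0ℤ + q * 1ℤ) * c) (a≡a%n+[a/n]*n a c))
        (reduce (+ r) q c))) (∣-i∣≡∣i∣ (+ r))

    -- Well-founded induction on the absolute value of the lower left entry. Splitting that entry by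
    -- sign lets the `NonZero` instance of `euclidStep` compute.
    euclid : ∀ A → Acc ℕ._<_ ∣ a₂₁ A ∣ → A ∈ K
    euclid A@(sl (mat a b (+ zero) d) _) _ = upperTriangular∈K A refl
    euclid A@(sl (mat a b +[1+ _ ] d) _) (acc rec) = euclidStep A λ B B<A → euclid B (rec B<A)
    euclid A@(sl (mat a b -[1+ _ ] d) _) (acc rec) = euclidStep A λ B B<A → euclid B (rec B<A)

  -- Generation is phrased through an arbitrary subgroup `K` containing `s` and `u`, so that `K` can
  -- be the commutant of a graph automorphism.
  generated-by-s-and-u : ∀ A → A ∈ K
  generated-by-s-and-u A = euclid A (<-wellFounded _)

-- Cyclic subgroups and powers of an element of finite order

module _ {c ℓ} {Γ : Group c ℓ} where
  open Group Γ using (_≈_; _∙_; ε; identityʳ; ∙-cong; sym; trans; rawMonoid; monoid; setoid)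
  open RawMonoid rawMonoid renaming (_×_ to _⨯_)
  open MonoidMult monoid using (×-homo-1; ×-homo-+; ×-assocˡ; ×-congʳ)
  open GroupProperties Γ using (inverseʳ-unique)

  generated-least : (K : Subgroup Γ p) → ∀ {g h} → g ∈ K → Generated Γ g h → h ∈ K
  generated-least K g∈ gen         = g∈
  generated-least K g∈ unit        = Subgroup.ε-mem K
  generated-least K g∈ (mul x y)   =
    Subgroup.∙-mem K (generated-least K g∈ x) (generated-least K g∈ y)
  generated-least K g∈ (inv x)     = Subgroup.⁻¹-mem K (generated-least K g∈ x)
  generated-least K g∈ (equal e x) = Subgroup.resp K e (generated-least K g∈ x)

  power∈ : (K : Subgroup Γ p) → ∀ {g} → g ∈ K → ∀ n → (n ⨯ g) ∈ K
  power∈ K g∈ zero    = Subgroup.ε-mem K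
  power∈ K g∈ (suc n) = Subgroup.∙-mem K g∈ (power∈ K g∈ n)

  module _ {g} n .{{_ : ℕ.NonZero n}} (gⁿ≈ε : (n ⨯ g) ≈ ε) where
    open SetoidReasoning setoid

    multiple-of-order : ∀ k → ((k ℕ.* n) ⨯ g) ≈ ε
    multiple-of-order k = begin
      (k ℕ.* n) ⨯ g  ≈⟨ ×-assocˡ g k n ⟨
      k ⨯ (n ⨯ g)    ≈⟨ ×-congʳ k gⁿ≈ε ⟩
      k ⨯ ε          ≈⟨ ε-power k ⟩
      ε              ∎
      where
      ε-power : ∀ k → (k ⨯ ε) ≈ ε
      ε-power zero    = Group.refl Γ
      ε-power (suc k) = trans (Group.identityˡ Γ _) (ε-power k)

    -- Induction on the derivation of membership. Finite order turns inverses into powers with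
    -- natural exponents: k + k (n - 1) = k n, so the k (n - 1)-th power inverts the k-th.
    finite-order⇒ℕ-power : ∀ {h} → Generated Γ g h → Σ ℕ λ k → h ≈ (k ⨯ g)
    finite-order⇒ℕ-power gen         = 1 , sym (×-homo-1 g)
    finite-order⇒ℕ-power unit        = 0 , Group.refl Γ
    finite-order⇒ℕ-power (mul x y)   =
      let j , x≈ = finite-order⇒ℕ-power x
          k , y≈ = finite-order⇒ℕ-power y
      in j ℕ.+ k , trans (∙-cong x≈ y≈) (sym (×-homo-+ g j k))
    finite-order⇒ℕ-power (inv {x} x′) =
      let k , x≈ = finite-order⇒ℕ-power x′
      in k ℕ.* ℕ.pred n , sym (inverseʳ-unique x _ (begin
        x ∙ ((k ℕ.* ℕ.pred n) ⨯ g)       ≈⟨ ∙-cong x≈ (Group.refl Γ) ⟩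
        (k ⨯ g) ∙ ((k ℕ.* ℕ.pred n) ⨯ g) ≈⟨ ×-homo-+ g k _ ⟨
        (k ℕ.+ k ℕ.* ℕ.pred n) ⨯ g       ≡⟨ cong (_⨯ g) (ℕ.*-suc k (ℕ.pred n)) ⟨
        (k ℕ.* suc (ℕ.pred n)) ⨯ g       ≡⟨ cong (λ m → (k ℕ.* m) ⨯ g) (ℕ.suc-pred n) ⟩
        (k ℕ.* n) ⨯ g                    ≈⟨ multiple-of-order k ⟩
        ε                                ∎))
    finite-order⇒ℕ-power (equal x≈y x) =
      let k , x≈ = finite-order⇒ℕ-power x in k , trans (sym x≈y) x≈

    finite-order⇒power : ∀ {h} → Generated Γ g h → Σ (Fin n) λ i → h ≈ (toℕ i ⨯ g)
    finite-order⇒power {h} h∈ = fromℕ< (ℕ.m%n<n k n) , (begin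
      h                                          ≈⟨ h≈ ⟩
      k ⨯ g                                      ≡⟨ cong (_⨯ g) (ℕ.m≡m%n+[m/n]*n k n) ⟩
      (k ℕ.% n ℕ.+ (k ℕ./ n) ℕ.* n) ⨯ g          ≈⟨ ×-homo-+ g (k ℕ.% n) _ ⟩
      ((k ℕ.% n) ⨯ g) ∙ (((k ℕ./ n) ℕ.* n) ⨯ g)  ≈⟨ ∙-cong (Group.refl Γ) (multiple-of-order (k ℕ./ n)) ⟩
      ((k ℕ.% n) ⨯ g) ∙ ε                        ≈⟨ identityʳ _ ⟩
      (k ℕ.% n) ⨯ g                              ≡⟨ cong (_⨯ g) (toℕ-fromℕ< (ℕ.m%n<n k n)) ⟨
      toℕ (fromℕ< (ℕ.m%n<n k n)) ⨯ g             ∎)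
      where
      k = proj₁ (finite-order⇒ℕ-power h∈)
      h≈ = proj₂ (finite-order⇒ℕ-power h∈)

-- Stabilisers, orbits and commutants in right Γ-sets

module _ {c ℓ a} {Γ : Group c ℓ} (X : RightSet Γ a p) where
  open RightSet X
  open Setoid setoid using (_≈_; Carrier; sym) renaming (refl to X-refl)
  open Group Γ using (_∙_; _⁻¹; ε; inverseʳ) renaming (refl to Γ-refl)
  open SetoidReasoning setoid

  stabiliser : Carrier → Subgroup Γ p
  stabiliser x = record
    { Member = λ h → x · h ≈ x
    ; resp   = λ {h} {k} h≈k xh≈x → begin
        x · k  ≈⟨ ·-cong X-refl h≈k ⟨
        x · h  ≈⟨ xh≈x ⟩
        x      ∎
    ; ε-mem  = ·-identity x
    ; ∙-mem  = λ {h} {k} xh≈x xk≈x → begin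
        x · (h ∙ k)  ≈⟨ ·-assoc x h k ⟩
        x · h · k    ≈⟨ ·-cong xh≈x Γ-refl ⟩
        x · k        ≈⟨ xk≈x ⟩
        x            ∎
    ; ⁻¹-mem = λ {h} xh≈x → begin
        x · h ⁻¹        ≈⟨ ·-cong xh≈x Γ-refl ⟨
        x · h · h ⁻¹    ≈⟨ ·-assoc x h (h ⁻¹) ⟨
        x · (h ∙ h ⁻¹)  ≈⟨ ·-cong X-refl (inverseʳ h) ⟩
        x · ε           ≈⟨ ·-identity x ⟩
        x               ∎
    }

  module _ {x : Carrier} {g : Group.Carrier Γ} where
    open RawMonoid (Group.rawMonoid Γ) renaming (_×_ to _⨯_)
    open MonoidMult (Group.monoid Γ) using (×-homo-1; ×-homo-+)

    private
      shift : ∀ {i j} k → x · (i ⨯ g) ≈ x · (j ⨯ g) → x · ((i ℕ.+ k) ⨯ g) ≈ x · ((j ℕ.+ k) ⨯ g)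
      shift {i} {j} k eq = begin
        x · ((i ℕ.+ k) ⨯ g)      ≈⟨ ·-cong X-refl (×-homo-+ g i k) ⟩
        x · ((i ⨯ g) ∙ (k ⨯ g))  ≈⟨ ·-assoc x _ _ ⟩
        x · (i ⨯ g) · (k ⨯ g)    ≈⟨ ·-cong eq Γ-refl ⟩
        x · (j ⨯ g) · (k ⨯ g)    ≈⟨ ·-assoc x _ _ ⟨
        x · ((j ⨯ g) ∙ (k ⨯ g))  ≈⟨ ·-cong X-refl (×-homo-+ g j k) ⟨
        x · ((j ℕ.+ k) ⨯ g)      ∎

    -- Since 3 is prime, a coincidence between two of x, x g, x g² already forces x g = x.
    order-3-orbit : Group._≈_ Γ (3 ⨯ g) ε → ¬ (x · g ≈ x) →
                    ∀ (i j : Fin 3) → x · (toℕ i ⨯ g) ≈ x · (toℕ j ⨯ g) → i ≡ j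
    order-3-orbit g³≈ε xg≉x = injective
      where
      x≉xg : ¬ (x · ε ≈ x · (1 ⨯ g))
      x≉xg eq = xg≉x (begin
        x · g        ≈⟨ ·-cong X-refl (×-homo-1 g) ⟨
        x · (1 ⨯ g)  ≈⟨ eq ⟨
        x · ε        ≈⟨ ·-identity x ⟩
        x            ∎)
      x≉xg² : ¬ (x · ε ≈ x · (2 ⨯ g))
      -- Acting by g on x = x g² gives x g = x g³ = x.
      x≉xg² eq = x≉xg (begin
        x · ε        ≈⟨ ·-cong X-refl g³≈ε ⟨
        x · (3 ⨯ g)  ≈⟨ shift {0} {2} 1 eq ⟨
        x · (1 ⨯ g)  ∎)
      xg≉xg² : ¬ (x · (1 ⨯ g) ≈ x · (2 ⨯ g))
      -- Acting by g² on x g = x g² gives x = x g³ = x g⁴ = x g.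
      xg≉xg² eq = x≉xg (begin
        x · ε              ≈⟨ ·-cong X-refl g³≈ε ⟨
        x · (3 ⨯ g)        ≈⟨ shift {1} {2} 2 eq ⟩
        x · (g ∙ (3 ⨯ g))  ≈⟨ ·-cong X-refl (Group.∙-congˡ Γ g³≈ε) ⟩
        x · (1 ⨯ g)        ∎)
      injective : ∀ (i j : Fin 3) → x · (toℕ i ⨯ g) ≈ x · (toℕ j ⨯ g) → i ≡ j
      injective 0F 0F _  = refl
      injective 0F 1F eq = contradiction eq x≉xg
      injective 0F 2F eq = contradiction eq x≉xg²
      injective 1F 0F eq = contradiction (sym eq) x≉xg
      injective 1F 1F _  = refl
      injective 1F 2F eq = contradiction eq xg≉xg²
      injective 2F 0F eq = contradiction (sym eq) x≉xg²
      injective 2F 1F eq = contradiction (sym eq) xg≉xg²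
      injective 2F 2F _  = refl

  module _ (f : Carrier → Carrier) (f-cong : ∀ {x y} → x ≈ y → f x ≈ f y) where
    -- Being a subgroup, it reduces equivariance of `f` to a check on generators.
    commutant : Subgroup Γ (a ⊔ p)
    commutant = record
      { Member = λ h → ∀ x → f (x · h) ≈ f x · h
      ; resp   = λ {h} {k} h≈k fh x → begin
          f (x · k)  ≈⟨ f-cong (·-cong X-refl h≈k) ⟨
          f (x · h)  ≈⟨ fh x ⟩
          f x · h    ≈⟨ ·-cong X-refl h≈k ⟩
          f x · k    ∎
      ; ε-mem  = λ x → begin
          f (x · ε)  ≈⟨ f-cong (·-identity x) ⟩
          f x        ≈⟨ ·-identity (f x) ⟨
          f x · ε    ∎
      ; ∙-mem  = λ {h} {k} fh fk x → begin
          f (x · (h ∙ k))  ≈⟨ f-cong (·-assoc x h k) ⟩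
          f (x · h · k)    ≈⟨ fk (x · h) ⟩
          f (x · h) · k    ≈⟨ ·-cong (fh x) Γ-refl ⟩
          f x · h · k      ≈⟨ ·-assoc (f x) h k ⟨
          f x · (h ∙ k)    ∎
      ; ⁻¹-mem = λ {h} fh x → begin
          f (x · h ⁻¹)              ≈⟨ ·-identity _ ⟨
          f (x · h ⁻¹) · ε          ≈⟨ ·-cong X-refl (inverseʳ h) ⟨
          f (x · h ⁻¹) · (h ∙ h ⁻¹) ≈⟨ ·-assoc _ h (h ⁻¹) ⟩
          f (x · h ⁻¹) · h · h ⁻¹   ≈⟨ ·-cong (fh (x · h ⁻¹)) Γ-refl ⟨
          f (x · h ⁻¹ · h) · h ⁻¹   ≈⟨ ·-cong (f-cong (·-assoc x (h ⁻¹) h)) Γ-refl ⟨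
          f (x · (h ⁻¹ ∙ h)) · h ⁻¹ ≈⟨ ·-cong (f-cong (·-cong X-refl (Group.inverseˡ Γ h))) Γ-refl ⟩
          f (x · ε) · h ⁻¹          ≈⟨ ·-cong (f-cong (·-identity x)) Γ-refl ⟩
          f x · h ⁻¹                ∎
      }

-- Orbits and valencies under automorphisms of an orbit graph

module _ {Γ : Group 0ℓ 0ℓ} (X : RightSet Γ 0ℓ p) (H : VertexType → Subgroup Γ 0ℓ)
         (g : Group.Carrier Γ) where
  open RightSet X
  open Setoid setoid using (_≈_; Carrier; sym; trans) renaming (refl to X-refl)
  open Group Γ using (ε; rawMonoid) renaming (_≈_ to _≈Γ_)
  open RawMonoid rawMonoid renaming (_×_ to _⨯_)
  open SetoidReasoning setoid

  private
    Y = orbitCyclicGraph X H g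
    module Orbit t = Setoid (orbits X (H t))

  open CyclicGraph Y using (HasValency)

  -- The edges at the vertex of `x` are the points of its orbit. The points x kⁱ with i < n exhaust
  -- it because these powers exhaust `H t`, and they are distinct by assumption.
  free-orbit-valency : ∀ t {k} n →
    (∀ {h} → h ∈ H t → Σ (Fin n) λ i → h ≈Γ (toℕ i ⨯ k)) → k ∈ H t →
    ∀ x → (∀ (i j : Fin n) → x · (toℕ i ⨯ k) ≈ x · (toℕ j ⨯ k) → i ≡ j) →
    HasValency t x n
  free-orbit-valency t {k} n power k∈ x injective = record
    { to        = λ i → point i , Orbit.sym t {x} {point i} (toℕ i ⨯ k , power∈ (H t) k∈ (toℕ i) , X-refl)
    ; from      = λ (e , e~x) → index e e~x
    ; to-cong   = λ { ≡.refl → X-refl }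
    -- The index is read off from the witness that the edge lies in the orbit; injectivity makes it
    -- independent of that witness.
    ; from-cong = λ {(e , e~x)} {(e′ , e′~x)} e≈e′ → injective (index e e~x) (index e′ e′~x)
        (trans (point-index e e~x) (trans e≈e′ (sym (point-index e′ e′~x))))
    ; inverse   = (λ { {e , e~x} ≡.refl → point-index e e~x })
                , (λ {i} {(e , e~x)} e≈ → injective (index e e~x) i (trans (point-index e e~x) e≈))
    }
    where
    point : Fin n → Carrier
    point i = x · (toℕ i ⨯ k)
    module _ (e : Carrier) (e~x : Orbit._≈_ t e x) where
      private
        x~e = Orbit.sym t {e} {x} e~x
        h-power = power (proj₁ (proj₂ x~e))
      index : Fin n
      index = proj₁ h-power
      point-index : point index ≈ e
      point-index = trans (sym (·-cong X-refl (proj₂ h-power))) (proj₂ (proj₂ x~e))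

  -- Every vertex is the endpoint of an edge, namely of any point representing the orbit, so
  -- compatibility fixes the vertex maps.
  edges-determine : ∀ {f f′ : Automorphism Y} →
    (∀ x → Automorphism.onEdges f x ≈ Automorphism.onEdges f′ x) →
    Group._≈_ (automorphismGroup Y) f f′
  edges-determine {f} {f′} f≈f′ = f≈f′ , λ t v →
    let open Automorphism in
    Orbit.trans t {onVertices f t v} {onEdges f v} {onVertices f′ t v}
      (Orbit.sym t {onEdges f v} {onVertices f t v} (compatible f t v))
      (Orbit.trans t {onEdges f v} {onEdges f′ v} {onVertices f′ t v}
        (Func.cong (CyclicGraph.end Y t) (f≈f′ v)) (compatible f′ t v))

  Equivariant : Automorphism Y → Set p
  Equivariant f = ∀ x h → onEdges (x · h) ≈ onEdges x · h
    where open Automorphism f using (onEdges)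

  module _ (f : Automorphism Y) where
    open Automorphism f using (vertex; onEdges; onVertices; compatible)

    preserves-orbits : ∀ t {x y} → Orbit._≈_ t x y → Orbit._≈_ t (onEdges x) (onEdges y)
    preserves-orbits t {x} {y} x~y =
      Orbit.trans t {onEdges x} {onVertices t x} {onEdges y} (compatible t x)
        (Orbit.trans t {onVertices t x} {onVertices t y} {onEdges y}
          (Inverse.to-cong (vertex t) x~y)
          (Orbit.sym t {onEdges y} {onVertices t y} (compatible t y)))

  -- The inverse automorphism takes the image of `x`, moved by `h`, back into the orbit of `x`,
  -- which is the single point `x`.
  preserves-fixed-points : ∀ (f : Automorphism Y) t {x h} → h ∈ H t →
    (∀ {k} → k ∈ H t → x · k ≈ x) →
    Automorphism.onEdges f x · h ≈ Automorphism.onEdges f x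
  preserves-fixed-points f t {x} {h} h∈ fixed = begin
    to x · h              ≈⟨ strictlyInverseˡ (to x · h) ⟨
    to (from (to x · h))  ≈⟨ to-cong preimage≈x ⟩
    to x                  ∎
    where
    open Inverse (Automorphism.edge f)
    x~preimage : Orbit._≈_ t x (from (to x · h))
    x~preimage = Orbit.trans t {x} {from (to x)} {from (to x · h)}
      (ε , Subgroup.ε-mem (H t) , trans (·-identity x) (sym (strictlyInverseʳ x)))
      (preserves-orbits (inverseAut Y f) t {to x} {to x · h} (h , h∈ , X-refl))
    preimage≈x : from (to x · h) ≈ x
    preimage≈x = trans (sym (proj₂ (proj₂ x~preimage))) (fixed (proj₁ (proj₂ x~preimage)))

-- Equivariance of automorphisms under PSL₂(ℤ)

module _ (em : ExcludedMiddle p) (X : RightSet PSL₂ℤ 0ℓ p)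
         (f : Automorphism (orbitCyclicGraph X G[_] u)) where
  open RightSet X
  open Setoid setoid using (_≈_; sym; trans) renaming (refl to X-refl)
  open Group PSL₂ℤ using (_∙_; ε; rawMonoid) renaming (_≈_ to _≈Γ_)
  open RawMonoid rawMonoid renaming (_×_ to _⨯_)
  open MonoidMult (Group.monoid PSL₂ℤ) using (×-homo-1)
  open SetoidReasoning setoid
  open Automorphism f using (onEdges; edge; cyclic)

  private
    -- As matrices, s² and u³ are both `-I`, hence the second summand of membership in `±I`.
    s² : (2 ⨯ s) ≈Γ ε
    s² = inj₂ refl

    u³ : (3 ⨯ u) ≈Γ ε
    u³ = inj₂ refl

    -- The case of valency 1: the stabiliser of `x` contains the generator `k`, hence all of
    -- `G[ t ]`, and then `k` fixes the image of `x` too.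
    fixed-point : ∀ t {x} k → (∀ {h} → h ∈ G[ t ] → h ∈ generatedBy PSL₂ℤ k) → k ∈ G[ t ] →
                  x · k ≈ x → onEdges (x · k) ≈ onEdges x · k
    fixed-point t {x} k G[t]⊆ k∈ xk≈x = begin
      onEdges (x · k)  ≈⟨ Inverse.to-cong edge xk≈x ⟩
      onEdges x        ≈⟨ preserves-fixed-points X G[_] u f t {x} {k} k∈
                            (λ h∈ → generated-least (stabiliser X x) xk≈x (G[t]⊆ h∈)) ⟨
      onEdges x · k    ∎

    commutes-with-s : ∀ x → onEdges (x · s) ≈ onEdges x · s
    commutes-with-s x with preserves-orbits X G[_] u f type0 {x} {x · s} (s , gen , X-refl)
    ... | h , h∈ , eq with finite-order⇒power {Γ = PSL₂ℤ} {s} 2 s² h∈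
    -- Here `x` and `x · s` have the same image, so injectivity on edges gives x s = x.
    ... | 0F , h≈ε = fixed-point type0 {x} s (λ h∈ → h∈) gen
      (trans (sym (Inverse.inverseʳ edge (begin
        onEdges x        ≈⟨ ·-identity _ ⟨
        onEdges x · ε    ≈⟨ ·-cong X-refl h≈ε ⟨
        onEdges x · h    ≈⟨ eq ⟩
        onEdges (x · s)  ∎))) (Inverse.strictlyInverseʳ edge x))
    ... | 1F , h≈s = begin
      onEdges (x · s)     ≈⟨ eq ⟨
      onEdges x · h       ≈⟨ ·-cong X-refl h≈s ⟩
      onEdges x · (1 ⨯ s) ≈⟨ ·-cong X-refl (×-homo-1 s) ⟩
      onEdges x · s       ∎

    -- If `u` moves `x`, the vertex is trivalent, so x, x u, x u² form a cyclic triple. Its image is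
    -- again one, and the second entry of a cyclic triple is the first times `u`.
    commutes-with-u : ∀ x → onEdges (x · u) ≈ onEdges x · u
    -- Excluded middle decides between valency 1 and valency 3.
    commutes-with-u x with em {x · u ≈ x}
    ... | yes xu≈x = fixed-point type1 {x} u (λ h∈ → h∈) gen xu≈x
    ... | no  xu≉x = proj₁ (proj₂ (Equivalence.to (cyclic x (x · u) (x · (u ∙ u)))
      (free-orbit-valency X G[_] u type1 {u} 3 (finite-order⇒power {Γ = PSL₂ℤ} 3 u³) gen x
        (order-3-orbit X u³ xu≉x) , X-refl , X-refl)))

  automorphism-equivariant : Equivariant X G[_] u f
  automorphism-equivariant x h = generated-by-s-and-u
    (commutant X onEdges (Inverse.to-cong edge)) commutes-with-s commutes-with-u h x

-- Translations of the coset graph by the normaliser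

module _ {Γ : Group 0ℓ 0ℓ} (G : Subgroup Γ p) (H : VertexType → Subgroup Γ 0ℓ)
         (g : Group.Carrier Γ) where
  open Group Γ using (_≈_; _∙_; _⁻¹; ε; assoc; identityˡ; identityʳ; ∙-cong; ∙-congˡ; ⁻¹-cong; trans)
  open GroupProperties Γ using (\\-leftDividesˡ; \\-leftDividesʳ; ε⁻¹≈ε)
  open Subgroup G using (resp)

  private
    Y = orbitCyclicGraph (rightCosets G) H g
    N = normaliser G
    open CyclicGraph Y
    module E = Setoid edges
    module V t = Setoid (vertices t)

  translate-edge : ∀ {n x y} → n ∈ N → E._≈_ x y → E._≈_ (n ∙ x) (n ∙ y)
  translate-edge {n} {x} {y} n∈ =
    coset-mulˡ G {x} {y} n (λ {h} → Equivalence.to (n∈ h))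

  -- Left multiplication commutes with the right action, so the same `h` links the translated
  -- points.
  translate-orbit : ∀ t {n x y} → n ∈ N → V._≈_ t x y → V._≈_ t (n ∙ x) (n ∙ y)
  translate-orbit t {n} {x} {y} n∈ (h , h∈ , xh≈y) = h , h∈ ,
    E.trans {n ∙ x ∙ h} {n ∙ (x ∙ h)} {n ∙ y}
      (coset-reflexive G (assoc n x h)) (translate-edge n∈ xh≈y)

  private
    orbit-reflexive : ∀ t {x y} → x ≈ y → V._≈_ t x y
    orbit-reflexive t x≈y = Func.cong (end t) (coset-reflexive G x≈y)

  -- Carries the valency condition inside `Cyclic` along a translation.
  translate-star : ∀ t {n v} → n ∈ N → Inverse (star t v) (star t (n ∙ v))
  translate-star t {n} {v} n∈ = record
    { to        = λ (e , e~v) → n ∙ e , translate-orbit t {n} {e} {v} n∈ e~v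
    ; from      = λ (e , e~nv) → n ⁻¹ ∙ e ,
        V.trans t {n ⁻¹ ∙ e} {n ⁻¹ ∙ (n ∙ v)} {v}
          (translate-orbit t {n ⁻¹} {e} {n ∙ v} n⁻¹∈ e~nv)
          (orbit-reflexive t (\\-leftDividesʳ n v))
    ; to-cong   = translate-edge n∈
    ; from-cong = translate-edge n⁻¹∈
    ; inverse   =
        (λ {e} {d} d≈ → E.trans {n ∙ proj₁ d} {n ∙ (n ⁻¹ ∙ proj₁ e)} {proj₁ e}
          (translate-edge n∈ d≈) (coset-reflexive G (\\-leftDividesˡ n (proj₁ e))))
      , (λ {e} {d} d≈ → E.trans {n ⁻¹ ∙ proj₁ d} {n ⁻¹ ∙ (n ∙ proj₁ e)} {proj₁ e}
          (translate-edge n⁻¹∈ d≈) (coset-reflexive G (\\-leftDividesʳ n (proj₁ e))))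
    }
    where n⁻¹∈ = Subgroup.⁻¹-mem N n∈

  translate-cyclic : ∀ {n x y z} → n ∈ N → Cyclic x y z → Cyclic (n ∙ x) (n ∙ y) (n ∙ z)
  translate-cyclic {n} {x} {y} {z} n∈ (valency , y≈ , z≈) =
    Compose.inverse valency (translate-star type1 n∈) , shift y≈ , shift z≈
    where
    shift : ∀ {y h} → E._≈_ y (x ∙ h) → E._≈_ (n ∙ y) (n ∙ x ∙ h)
    shift {y} {h} y≈ = E.trans {n ∙ y} {n ∙ (x ∙ h)} {n ∙ x ∙ h}
      (translate-edge n∈ y≈) (E.sym {n ∙ x ∙ h} {n ∙ (x ∙ h)} (coset-reflexive G (assoc n x h)))

  translation : Group.Carrier (normaliserQuotient G) → Automorphism Y
  translation (n , n∈) = record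
    { edge       = record
      { to        = n ∙_
      ; from      = n ⁻¹ ∙_
      ; to-cong   = translate-edge n∈
      ; from-cong = translate-edge n⁻¹∈
      ; inverse   =
          (λ {e} {d} d≈ → E.trans {n ∙ d} {n ∙ (n ⁻¹ ∙ e)} {e}
            (translate-edge n∈ d≈) (coset-reflexive G (\\-leftDividesˡ n e)))
        , (λ {e} {d} d≈ → E.trans {n ⁻¹ ∙ d} {n ⁻¹ ∙ (n ∙ e)} {e}
            (translate-edge n⁻¹∈ d≈) (coset-reflexive G (\\-leftDividesʳ n e)))
      }
    ; vertex     = λ t → record
      { to        = n ∙_
      ; from      = n ⁻¹ ∙_
      ; to-cong   = λ {v} {w} → translate-orbit t {n} {v} {w} n∈
      ; from-cong = λ {v} {w} → translate-orbit t {n ⁻¹} {v} {w} n⁻¹∈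
      ; inverse   =
          (λ {e} {d} d~ → V.trans t {n ∙ d} {n ∙ (n ⁻¹ ∙ e)} {e}
            (translate-orbit t {n} {d} {n ⁻¹ ∙ e} n∈ d~) (orbit-reflexive t (\\-leftDividesˡ n e)))
        , (λ {e} {d} d~ → V.trans t {n ⁻¹ ∙ d} {n ⁻¹ ∙ (n ∙ e)} {e}
            (translate-orbit t {n ⁻¹} {d} {n ∙ e} n⁻¹∈ d~) (orbit-reflexive t (\\-leftDividesʳ n e)))
      }
    ; compatible = λ t e → V.refl t {n ∙ e}
    -- For the converse, translate back by `n ⁻¹`.
    ; cyclic     = λ x y z → mk⇔ (translate-cyclic n∈) λ nxyz →
        cyclic-resp (cancel x) (cancel y) (cancel z) (translate-cyclic n⁻¹∈ nxyz)
    }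
    where
    n⁻¹∈ = Subgroup.⁻¹-mem N n∈
    cancel : ∀ x → E._≈_ (n ⁻¹ ∙ (n ∙ x)) x
    cancel x = coset-reflexive G (\\-leftDividesʳ n x)

  open GroupMorphisms (Group.rawGroup (normaliserQuotient G)) (Group.rawGroup (automorphismGroup Y))

  translation-isGroupMonomorphism : IsGroupMonomorphism translation
  translation-isGroupMonomorphism = record
    { isGroupHomomorphism = record
      { isMonoidHomomorphism = record
        { isMagmaHomomorphism = record
          { isRelHomomorphism = record
            { cong = λ {n} {m} n≈m → determined {translation n} {translation m}
                λ x → coset-mulʳ G {proj₁ n} {proj₁ m} x n≈m }
          ; homo = λ n@(n′ , n∈) m@(m′ , m∈) →
              determined {translation (n′ ∙ m′ , Subgroup.∙-mem N n∈ m∈)}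
                {composeAut Y (translation n) (translation m)}
                λ x → coset-reflexive G (assoc n′ m′ x)
          }
        ; ε-homo = determined {translation (ε , Subgroup.ε-mem N)} {identityAut Y}
            λ x → coset-reflexive G (identityˡ x)
        }
      ; ⁻¹-homo = λ n@(n′ , n∈) →
          determined {translation (n′ ⁻¹ , Subgroup.⁻¹-mem N n∈)} {inverseAut Y (translation n)}
            λ x → E.refl {n′ ⁻¹ ∙ x}
      }
    -- Evaluating both translations at the coset of `ε` gives G n = G m.
    ; injective = λ {n} {m} (n≈m , _) →
        resp (∙-cong (identityʳ (proj₁ n)) (⁻¹-cong (identityʳ (proj₁ m)))) (n≈m ε)
    }
    where
    determined = λ {f} {f′} → edges-determine (rightCosets G) H g {f} {f′}

  module _ (f : Automorphism Y) (equivariant : Equivariant (rightCosets G) H g f) where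
    open Automorphism f using (edge; onEdges)

    onEdges≈translation : ∀ x → E._≈_ (onEdges x) (onEdges ε ∙ x)
    onEdges≈translation x = E.trans {onEdges x} {onEdges (ε ∙ x)} {onEdges ε ∙ x}
      (Inverse.to-cong edge {x} {ε ∙ x} (E.sym {ε ∙ x} {x} (coset-reflexive G (identityˡ x))))
      (equivariant ε x)

    -- Membership of h in G reads G h = G, that of n h n⁻¹ reads G n h = G n,
    -- and f takes the first pair of cosets to the second.
    image-of-ε∈normaliser : onEdges ε ∈ N
    image-of-ε∈normaliser h = mk⇔
      (λ h∈ → E.trans {n ∙ h} {onEdges h} {n} (E.sym {onEdges h} {n ∙ h} (onEdges≈translation h))
        (Inverse.to-cong edge {h} {ε} (resp (Group.sym Γ h//ε≈h) h∈)))
      (λ nhn⁻¹∈ → resp h//ε≈h (E.trans {h} {Inverse.from edge n} {ε}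
        (E.sym {Inverse.from edge n} {h} (Inverse.inverseʳ edge
          (E.trans {n} {n ∙ h} {onEdges h} (E.sym {n ∙ h} {n} nhn⁻¹∈)
            (E.sym {onEdges h} {n ∙ h} (onEdges≈translation h)))))
        (Inverse.strictlyInverseʳ edge ε)))
      where
      n = onEdges ε
      h//ε≈h : h ∙ ε ⁻¹ ≈ h
      h//ε≈h = trans (∙-congˡ ε⁻¹≈ε) (identityʳ h)

  translation-isGroupIsomorphism :
    (∀ f → Equivariant (rightCosets G) H g f) →
    IsGroupIsomorphism translation
  translation-isGroupIsomorphism equivariant = record
    { isGroupMonomorphism = translation-isGroupMonomorphism
    -- The preimage is the class of the image of the trivial coset; surjectivity asks that every
    -- representative `m` of this class induces `f`.
    ; surjective = λ f → let open Automorphism f using (onEdges) in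
        (onEdges ε , image-of-ε∈normaliser f (equivariant f)) , λ {m} m≈n →
          edges-determine (rightCosets G) H g {translation m} {f} λ x →
            E.trans {proj₁ m ∙ x} {onEdges ε ∙ x} {onEdges x}
              (coset-mulʳ G {proj₁ m} {onEdges ε} x m≈n)
              (E.sym {onEdges x} {onEdges ε ∙ x} (onEdges≈translation f (equivariant f) x))
    }

-- Separates the formal part, valid for any group, from equivariance, through which the structure of
-- PSL₂(ℤ) enters. The last two clauses say that the isomorphism is the one induced by the action on
-- cosets.
automorphisms-are-translations : {Γ : Group 0ℓ 0ℓ} (G : Subgroup Γ p)
    (H : VertexType → Subgroup Γ 0ℓ) (g : Group.Carrier Γ) →
    (∀ f → Equivariant (rightCosets G) H g f) →
    let Ycomb = orbitCyclicGraph (rightCosets G) H g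
        open Group Γ using (_∙_)
        open CyclicGraph Ycomb
        N/G = normaliserQuotient G
        Aut = automorphismGroup Ycomb
    in Σ (Group.Carrier N/G → Group.Carrier Aut) λ φ →
         GroupMorphisms.IsGroupIsomorphism (Group.rawGroup N/G) (Group.rawGroup Aut) φ
         × (∀ n x → Setoid._≈_ edges (Automorphism.onEdges (φ n) x) (proj₁ n ∙ x))
         × (∀ n t x → Setoid._≈_ (vertices t)
              (Automorphism.onVertices (φ n) t (endpoint t x)) (endpoint t (proj₁ n ∙ x)))
automorphisms-are-translations {Γ = Γ} G H g equivariant =
    translation G H g
  , translation-isGroupIsomorphism G H g equivariant
  , (λ n x → Setoid.refl edges {proj₁ n ∙ x})
  , (λ n t x → Setoid.refl (vertices t) {proj₁ n ∙ x})
  where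
  open Group Γ using (_∙_)
  open CyclicGraph (orbitCyclicGraph (rightCosets G) H g)

proposition4p2 : ∀ {ℓ} → ExcludedMiddle ℓ → (G : Subgroup PSL₂ℤ ℓ) →
    let Ycomb = orbitCyclicGraph (rightCosets G) G[_] u
        open Group PSL₂ℤ using (_∙_)
        open CyclicGraph Ycomb
        N/G = normaliserQuotient G
        Aut = automorphismGroup Ycomb
    in Σ (Group.Carrier N/G → Group.Carrier Aut) λ φ →
         GroupMorphisms.IsGroupIsomorphism (Group.rawGroup N/G) (Group.rawGroup Aut) φ
         × (∀ n x → Setoid._≈_ edges (Automorphism.onEdges (φ n) x) (proj₁ n ∙ x))
         × (∀ n t x → Setoid._≈_ (vertices t)
              (Automorphism.onVertices (φ n) t (endpoint t x)) (endpoint t (proj₁ n ∙ x)))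
proposition4p2 em G = automorphisms-are-translations G G[_] u
  (automorphism-equivariant em (rightCosets G))
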